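{- Let $n,\ell$ be positive integers. There exists a graph $G_{n,\ell}$ of distance VC-dimension at most $18$ such that the $2$VC-dimension of the $B_\ell$-hypergraph of $G_{n,\ell}$ is at least $n$.
   Context: All graphs are finite and simple; $d_G$ is the shortest-path distance ($+\infty$ between different components) and $B_G(x,k)=\{y: d_G(x,y)\le k\}$. The $B_\ell$-hypergraph of $G=(V,E)$ has vertex set $V$ and one hyperedge $B_G(v,\ell)$ for each $v\in V$; the $B$-hypergraph has as hyperedges all balls $B_G(v,k)$, $v\in V$, $k\ge 0$ integer. A set $X$ is shattered (resp. $2$-shattered) by a hypergraph if for every $X'\subseteq X$ (resp. every $X'\subseteq X$ with $|X'|=2$) there is a hyperedge $e$ with $e\cap X=X'$. The VC-dimension (resp. $2$VC-dimension) is the maximum size of a shattered (resp. $2$-shattered) set. The distance VC-dimension of a graph $G$ is the maximum, over all induced subgraphs $G'$ of $G$, of the VC-dimension of the $B$-hypergraph of $G'$. -}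

module Defs where

open import Data.Nat using (ℕ; zero; suc; _≤_)
open import Data.Fin using (Fin)
open import Data.Bool using (Bool; true; false)
open import Data.Product using (Σ; ∃; _×_)
open import Data.Sum using (_⊎_)
open import Relation.Binary.PropositionalEquality using (_≡_)
open import Relation.Nullary using (¬_)
open import Function.Bundles using (_⇔_)

record Graph : Set where
  field
    size  : ℕ
    Adj   : Fin size → Fin size → Bool
    sym   : ∀ x y → Adj x y ≡ Adj y x
    irrefl : ∀ x → Adj x x ≡ false

open Graph public

-- Vertex subsets (determining induced subgraphs G[S]).
VSet : Graph → Set
VSet G = Fin (size G) → Bool

-- Walk k x y in the induced subgraph G[S]: a walk from x to y of length at
-- most k, all of whose vertices lie in S.  Hence  Walk G S k x y  holds iff
-- d_{G[S]}(x,y) ≤ k (for x ∈ S), i.e. y ∈ B_{G[S]}(x,k).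
data Walk (G : Graph) (S : VSet G) : ℕ → Fin (size G) → Fin (size G) → Set where
  here : ∀ {k x} → S x ≡ true → Walk G S k x x
  step : ∀ {k x z y} → S x ≡ true → Adj G x z ≡ true →
         Walk G S k z y → Walk G S (suc k) x y

all : (G : Graph) → VSet G
all G _ = true

InBall : (G : Graph) (S : VSet G) → Fin (size G) → ℕ → Fin (size G) → Set
InBall G S v k y = Walk G S k v y

Injective : ∀ {A B : Set} → (A → B) → Set
Injective f = ∀ i j → f i ≡ f j → i ≡ j

ShatteredB : (G : Graph) (S : VSet G) (d : ℕ) → (Fin d → Fin (size G)) → Set
ShatteredB G S d X =
  Injective X × (∀ i → S (X i) ≡ true) ×
  (∀ (Y : Fin d → Bool) →
     Σ (Fin (size G)) λ v → S v ≡ true × Σ ℕ λ k →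
       ∀ i → (InBall G S v k (X i) ⇔ (Y i ≡ true)))

DistVCdim≤ : Graph → ℕ → Set
DistVCdim≤ G D = ∀ (S : VSet G) (d : ℕ) (X : Fin d → Fin (size G)) →
  ShatteredB G S d X → d ≤ D

TwoShatteredBℓ : (G : Graph) (ℓ d : ℕ) → (Fin d → Fin (size G)) → Set
TwoShatteredBℓ G ℓ d X =
  Injective X ×
  (∀ (i j : Fin d) → ¬ (i ≡ j) →
     Σ (Fin (size G)) λ v →
       ∀ t → (InBall G (all G) v ℓ (X t) ⇔ (t ≡ i ⊎ t ≡ j)))

TwoVCdimBℓ≥ : Graph → ℕ → ℕ → Set
TwoVCdimBℓ≥ G ℓ n = Σ ℕ λ d → n ≤ d × Σ (Fin d → Fin (size G)) λ X →
  TwoShatteredBℓ G ℓ d X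

{-# OPTIONS --safe #-}
module Submission where

-- Take a clique of n hubs and, for all hubs i and j, an arm: a path of ℓ
-- vertices whose first vertex is joined to i and j.  The ball of radius ℓ
-- around the far end of the arm (i , j) meets the clique in {i , j}.
--
-- In an induced subgraph, two vertices on different branches (hubs or arms) of
-- one component are at distance depth + depth + ε with ε ∈ {0 , 1}, and ε = 0
-- exactly when their branches share a surviving hub.  A shattered set has at
-- most two points per branch, since balls are convex along a branch, so 19
-- points would give 10 on distinct branches.  Let w be one of least depth.  The
-- distance formula forces all but one of the others to the depth of w.  Of the
-- 8 points then left besides w, put one in every ball considered, to fix the
-- radius; a ball that avoids w cuts out of the other 7 the points attached to
-- one of the two hubs at the branch of its centre.  But 7 points attached to
-- at most two hubs each cannot have all their nonempty subsets of this form.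

open import Defs renaming (sym to Adj-sym; all to allVertices; Injective to Inj)
open import Data.Bool using (true)
open import Data.Bool.Properties using () renaming (_≟_ to _≟ᵇ_)
open import Data.Empty using (⊥; ⊥-elim)
open import Data.Fin using (Fin; zero; suc; toℕ; fromℕ; inject₁; inject≤; #_)
open import Data.Fin.Properties using (_≟_; any?; inject≤-injective; toℕ-injective; toℕ-inject₁; toℕ-fromℕ; +↔⊎; *↔×)
open import Data.List using (List; []; _∷_; length; filter; lookup; allFin)
open import Data.List.Membership.Propositional using (_∈_)
open import Data.List.Membership.Propositional.Properties using (∈-filter⁻; ∈-lookup)
open import Data.List.Properties using (filter-all; length-tabulate)
open import Data.List.Relation.Unary.All as All using (All; []; _∷_)
open import Data.List.Relation.Unary.AllPairs as AllPairs using (AllPairs; []; _∷_)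
import Data.List.Relation.Unary.AllPairs.Properties as AllPairsₚ
open import Data.List.Relation.Unary.Any using (here; there)
open import Data.List.Relation.Unary.Unique.Propositional.Properties using (allFin⁺)
open import Data.Nat using (ℕ; zero; suc; _+_; _*_; _≤_; _<_; z≤n; s≤s)
open import Data.Nat.Properties hiding (_≟_)
open import Data.Nat.Properties using () renaming (_≟_ to _≟ⁿ_)
open import Data.List.Extrema ≤-totalOrder using (argmin; f[argmin]≤f[⊤]; f[argmin]≤f[xs])
open import Data.Product using (Σ; ∃; ∃₂; _×_; _,_; proj₁; proj₂)
open import Data.Product.Function.NonDependent.Propositional using (_×-↔_)
import Data.Product.Properties as ×
open import Data.Sum using (_⊎_; inj₁; inj₂; [_,_]′; map₂)
open import Data.Sum.Function.Propositional using (_⊎-↔_)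
import Data.Sum.Properties as ⊎
open import Data.Unit using (⊤; tt)
open import Function using (_∘_; id; case_of_; _⇔_; mk⇔; Equivalence; _↔_; Inverse)
open import Function.Properties.Inverse using (↔-refl; ↔-trans)
open import Relation.Binary.Definitions using (tri<; tri≈; tri>)
open import Relation.Binary.PropositionalEquality using (_≡_; _≢_; refl; sym; trans; cong; subst)
open import Relation.Nullary using (¬_; Dec; yes; no; does; contradiction)
open import Relation.Nullary.Decidable using (¬?; _×-dec_; _⊎-dec_; decidable-stable; dec-true; dec-false; does-⇔)
open import Relation.Unary using (Decidable)

open Equivalence

does⇔ : ∀ {A : Set} (a? : Dec A) → (does a? ≡ true) ⇔ A
does⇔ a? = mk⇔ (holds a?) (dec-true a?)
  where
  holds : ∀ {A : Set} (a? : Dec A) → does a? ≡ true → A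
  holds (yes a) _ = a

-- Filtering lists and choosing distinct keys.

module _ {I : Set} where

  -- Past the first entry that fails `P`, the hypothesis forces `P` on every later entry, so
  -- `filter` drops nothing more. `Q` carries side conditions on single entries.
  filter-loses-one : ∀ {P Q : I → Set} {R : I → I → Set} (P? : Decidable P) →
    (∀ {x y} → Q x → Q y → R x y → ¬ P x → ¬ P y → ⊥) →
    ∀ {xs} → All Q xs → AllPairs R xs → length xs ≤ suc (length (filter P? xs))
  filter-loses-one P? one [] [] = z≤n
  filter-loses-one P? one {x ∷ xs} (q ∷ qs) (r ∷ rs) with P? x
  ... | yes _ = s≤s (filter-loses-one P? one qs rs)
  ... | no ¬p rewrite filter-all P? (All.map
          (λ (qy , rxy) → decidable-stable (P? _) (one q qy rxy ¬p))
          (All.zip (qs , r))) = ≤-refl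

  module _ {K : Set} (_≟ᴷ_ : (κ κ′ : K) → Dec (κ ≡ κ′)) (key : I → K)
    (atMostTwo : ∀ {x y z} → x ≢ y → x ≢ z → y ≢ z → key x ≡ key y → key x ≡ key z → ⊥) where

    -- Greedy choice: keep the head and drop the entries with its key, of which `atMostTwo` leaves
    -- at most one in the tail. The `suc` lets the last chosen entry come without a partner.
    distinctKeys : ∀ m xs → AllPairs _≢_ xs → m * 2 ≤ suc (length xs) →
      ∃ λ ys → AllPairs (λ x y → key x ≢ key y) ys × m ≤ length ys × (∀ {y} → y ∈ ys → y ∈ xs)
    distinctKeys zero xs _ _ = [] , [] , z≤n , λ ()
    distinctKeys (suc m) [] _ (s≤s ())
    distinctKeys (suc m) (x ∷ xs) (x≢ ∷ xs≢) (s≤s (s≤s le)) =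
      x ∷ proj₁ rec
      , All.tabulate (proj₂ ∘ ∈-filter⁻ other? {xs = xs} ∘ sub) ∷ proj₁ (proj₂ rec)
      , s≤s (proj₁ (proj₂ (proj₂ rec)))
      , λ { (here eq) → here eq ; (there y∈) → there (proj₁ (∈-filter⁻ other? (sub y∈))) }
      where
      other? : Decidable (λ y → key x ≢ key y)
      other? y = ¬? (key x ≟ᴷ key y)
      others-many : length xs ≤ suc (length (filter other? xs))
      others-many = filter-loses-one other?
        (λ x≢y x≢z y≢z ¬oy ¬oz → atMostTwo x≢y x≢z y≢z
          (decidable-stable (key x ≟ᴷ _) ¬oy) (decidable-stable (key x ≟ᴷ _) ¬oz))
        x≢ xs≢
      rec = distinctKeys m (filter other? xs) (AllPairsₚ.filter⁺ other? xs≢) (≤-trans le others-many)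
      sub = proj₂ (proj₂ (proj₂ rec))

  lookup-injective : ∀ {xs : List I} → AllPairs _≢_ xs → ∀ i j → lookup xs i ≡ lookup xs j → i ≡ j
  lookup-injective (_ ∷ _) zero zero _ = refl
  lookup-injective (x≢ ∷ _) zero (suc j) eq = contradiction eq (All.lookup x≢ (∈-lookup j))
  lookup-injective (x≢ ∷ _) (suc i) zero eq = contradiction (sym eq) (All.lookup x≢ (∈-lookup i))
  lookup-injective (_ ∷ xs≢) (suc i) (suc j) eq = cong suc (lookup-injective xs≢ i j eq)

-- Seven edges whose nonempty subsets are all unions of two stars.

module TwoStars {A : Set} (R : Fin 7 → A → Set) (R? : ∀ s i → Dec (R s i))
  (e₁ e₂ : Fin 7 → A) (ends : ∀ {s i} → R s i → i ≡ e₁ s ⊎ i ≡ e₂ s)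
  (cover : ∀ {P : Fin 7 → Set} → Decidable P → ∀ s → P s →
           ∃₂ λ i j → ∀ t → P t ⇔ (R t i ⊎ R t j))
  where

  private
    -- The elements of `Fin 7` act as edges with ends in `A`. `R` is incidence, possibly restricted
    -- to some of the ends, and the star of i consists of the s with `R s i`.
    Private : Fin 7 → A → Set
    Private s i = ∀ {t} → t ≢ s → ¬ R t i

    shared? : ∀ s i → (∃ λ t → t ≢ s × R t i) ⊎ Private s i
    shared? s i with any? (λ t → ¬? (t ≟ s) ×-dec R? t i)
    ... | yes shared = inj₁ shared
    ... | no ¬shared = inj₂ λ t≢s r → ¬shared (_ , t≢s , r)

    -- If both ends of s had further elements t₁ and t₂ in their stars, no
    -- union of two stars could contain s and avoid t₁ and t₂.
    privateEnd : ∀ s → Private s (e₁ s) ⊎ Private s (e₂ s)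
    privateEnd s with shared? s (e₁ s) | shared? s (e₂ s)
    ... | inj₂ p | _ = inj₁ p
    ... | inj₁ _ | inj₂ p = inj₂ p
    ... | inj₁ (t₁ , t₁≢s , r₁) | inj₁ (t₂ , t₂≢s , r₂)
      with cover (λ t → ¬? (t ≟ t₁) ×-dec ¬? (t ≟ t₂)) s (t₁≢s ∘ sym , t₂≢s ∘ sym)
    ... | i , j , iff = ⊥-elim ([ excluded inj₁ , excluded inj₂ ]′ (to (iff s) (t₁≢s ∘ sym , t₂≢s ∘ sym)))
      where
      excluded : ∀ {i′} → (∀ {t} → R t i′ → R t i ⊎ R t j) → R s i′ → ⊥
      excluded star r with ends r
      ... | inj₁ refl = proj₁ (from (iff t₁) (star r₁)) refl
      ... | inj₂ refl = proj₂ (from (iff t₂) (star r₂)) refl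

    -- One end of s is private, so only the other can be shared with another edge.
    publicEnd : ∀ s → ∃ λ c → ∀ {t i} → t ≢ s → R s i → R t i → i ≡ c
    publicEnd s with privateEnd s
    ... | inj₁ p = e₂ s , λ t≢s r r′ → [ (λ { refl → ⊥-elim (p t≢s r′) }) , (λ eq → eq) ]′ (ends r)
    ... | inj₂ p = e₁ s , λ t≢s r r′ → [ (λ eq → eq) , (λ { refl → ⊥-elim (p t≢s r′) }) ]′ (ends r)

    unique : ∀ {s t u i j} → t ≢ s → u ≢ s → R s i → R t i → R s j → R u j → i ≡ j
    unique {s} t≢s u≢s ri ti rj uj =
      trans (proj₂ (publicEnd s) t≢s ri ti) (sym (proj₂ (publicEnd s) u≢s rj uj))

    record Cluster (T : Fin 7 → Set) : Set where
      constructor cluster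
      field
        {p q} : Fin 7
        {i}   : A
        p∈T   : T p
        q∈T   : T q
        p≢q   : p ≢ q
        Rpi   : R p i
        Rqi   : R q i
        inside : ∀ {t} → R t i → T t

    Triple : (x y z t : Fin 7) → Set
    Triple x y z t = t ≡ x ⊎ t ≡ y ⊎ t ≡ z

    triple? : ∀ x y z → Decidable (Triple x y z)
    triple? x y z t = t ≟ x ⊎-dec t ≟ y ⊎-dec t ≟ z

    -- Pigeonhole: when two stars cover the triple, one of them contains two of its three members,
    -- and neither star leaves the triple.
    clusterIn : ∀ x y z → x ≢ y → x ≢ z → y ≢ z → Cluster (Triple x y z)
    clusterIn x y z x≢y x≢z y≢z with cover (triple? x y z) x (inj₁ refl)
    ... | i , j , iff
      with to (iff x) (inj₁ refl) | to (iff y) (inj₂ (inj₁ refl)) | to (iff z) (inj₂ (inj₂ refl))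
    ... | inj₁ a | inj₁ b | _      = cluster (inj₁ refl) (inj₂ (inj₁ refl)) x≢y a b (from (iff _) ∘ inj₁)
    ... | inj₂ a | inj₂ b | _      = cluster (inj₁ refl) (inj₂ (inj₁ refl)) x≢y a b (from (iff _) ∘ inj₂)
    ... | inj₁ a | inj₂ _ | inj₁ c = cluster (inj₁ refl) (inj₂ (inj₂ refl)) x≢z a c (from (iff _) ∘ inj₁)
    ... | inj₂ a | inj₁ _ | inj₂ c = cluster (inj₁ refl) (inj₂ (inj₂ refl)) x≢z a c (from (iff _) ∘ inj₂)
    ... | inj₁ _ | inj₂ b | inj₂ c = cluster (inj₂ (inj₁ refl)) (inj₂ (inj₂ refl)) y≢z b c (from (iff _) ∘ inj₂)
    ... | inj₂ _ | inj₁ b | inj₁ c = cluster (inj₂ (inj₁ refl)) (inj₂ (inj₂ refl)) y≢z b c (from (iff _) ∘ inj₁)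

    T₁ T₂ : Fin 7 → Set
    T₁ = Triple (# 0) (# 1) (# 2)
    T₂ = Triple (# 3) (# 4) (# 5)

    disjoint : ∀ {t} → T₁ t → ¬ T₂ t
    disjoint (inj₁ refl)        (inj₂ (inj₂ ()))
    disjoint (inj₂ (inj₁ refl)) (inj₂ (inj₂ ()))
    disjoint (inj₂ (inj₂ refl)) (inj₂ (inj₂ ()))

    6∉T₁ : ¬ T₁ (# 6)
    6∉T₁ (inj₂ (inj₂ ()))

    6∉T₂ : ¬ T₂ (# 6)
    6∉T₂ (inj₂ (inj₂ ()))

  -- The clusters of T₁ and T₂ supply p₁ and p₂ whose public ends reach nothing
  -- outside T₁ and T₂ respectively, so {p₁ , p₂ , 6} has no cluster.
  contradictory : ⊥
  contradictory
    with clusterIn (# 0) (# 1) (# 2) (λ ()) (λ ()) (λ ()) | clusterIn (# 3) (# 4) (# 5) (λ ()) (λ ()) (λ ())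
  ... | cluster {p₁} {q₁} {i₁} p₁∈ _ p₁≢q₁ Rp₁ Rq₁ in₁ | cluster {p₂} {q₂} {i₂} p₂∈ _ p₂≢q₂ Rp₂ Rq₂ in₂
    with clusterIn p₁ p₂ (# 6) (λ { refl → disjoint p₁∈ p₂∈ }) (λ { refl → 6∉T₁ p₁∈ }) (λ { refl → 6∉T₂ p₂∈ })
  ... | cluster {p} {q} {i} p∈ q∈ p≢q Rp Rq _ = go p∈ q∈
    where
    from₁ : ∀ {t} → t ≢ p₁ → R p₁ i → R t i → T₁ t
    from₁ t≢p₁ r rt with unique t≢p₁ (p₁≢q₁ ∘ sym) r rt Rp₁ Rq₁
    ... | refl = in₁ rt
    from₂ : ∀ {t} → t ≢ p₂ → R p₂ i → R t i → T₂ t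
    from₂ t≢p₂ r rt with unique t≢p₂ (p₂≢q₂ ∘ sym) r rt Rp₂ Rq₂
    ... | refl = in₂ rt
    go : Triple p₁ p₂ (# 6) p → Triple p₁ p₂ (# 6) q → ⊥
    go (inj₁ refl)        (inj₁ refl)        = p≢q refl
    go (inj₁ refl)        (inj₂ (inj₁ refl)) = disjoint (from₁ (p≢q ∘ sym) Rp Rq) p₂∈
    go (inj₁ refl)        (inj₂ (inj₂ refl)) = 6∉T₁ (from₁ (p≢q ∘ sym) Rp Rq)
    go (inj₂ (inj₁ refl)) (inj₁ refl)        = disjoint (from₁ p≢q Rq Rp) p₂∈
    go (inj₂ (inj₁ refl)) (inj₂ (inj₁ refl)) = p≢q refl
    go (inj₂ (inj₁ refl)) (inj₂ (inj₂ refl)) = 6∉T₂ (from₂ (p≢q ∘ sym) Rp Rq)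
    go (inj₂ (inj₂ refl)) (inj₁ refl)        = 6∉T₁ (from₁ p≢q Rq Rp)
    go (inj₂ (inj₂ refl)) (inj₂ (inj₁ refl)) = 6∉T₂ (from₂ p≢q Rq Rp)
    go (inj₂ (inj₂ refl)) (inj₂ (inj₂ refl)) = p≢q refl

-- Walks in an induced subgraph.

module _ {G : Graph} {S : VSet G} where

  walk-weaken : ∀ {k m x y} → k ≤ m → Walk G S k x y → Walk G S m x y
  walk-weaken _ (here s) = here s
  walk-weaken (s≤s k≤m) (step s adj w) = step s adj (walk-weaken k≤m w)

  walk-append : ∀ {k m x y z} → Walk G S k x y → Walk G S m y z → Walk G S (k + m) x z
  walk-append {k} {m} (here _) w = walk-weaken (m≤n+m m k) w
  walk-append (step s adj w) w′ = step s adj (walk-append w w′)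

  walk-start : ∀ {k x y} → Walk G S k x y → S x ≡ true
  walk-start (here s) = s
  walk-start (step s _ _) = s

  walk-snoc : ∀ {k x y z} → Walk G S k x y → Adj G y z ≡ true → S z ≡ true → Walk G S (suc k) x z
  walk-snoc (here s) adj sz = step s adj (here sz)
  walk-snoc (step s adj′ w) adj sz = step s adj′ (walk-snoc w adj sz)

  walk-reverse : ∀ {k x y} → Walk G S k x y → Walk G S k y x
  walk-reverse (here s) = here s
  walk-reverse (step s adj w) = walk-snoc (walk-reverse w) (trans (Adj-sym G _ _) adj) s

-- The clique of hubs with its arms.

module Hubs-and-arms (n ℓ : ℕ) where

  V Key : Set
  V   = Fin n ⊎ ((Fin n × Fin n) × Fin ℓ)
  Key = Fin n ⊎ (Fin n × Fin n)

  pattern hub i = inj₁ i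
  pattern arm β a = inj₂ (β , a)

  key : V → Key
  key = map₂ proj₁

  depth : V → ℕ
  depth (hub _)   = 0
  depth (arm _ a) = suc (toℕ a)

  -- A hub counts as its own foot, twice, so that hubs and arms obey one distance formula.
  feet : Key → Fin n × Fin n
  feet (inj₁ i) = i , i
  feet (inj₂ β) = β

  Foot : Key → Fin n → Set
  Foot κ i = i ≡ proj₁ (feet κ) ⊎ i ≡ proj₂ (feet κ)

  foot? : ∀ κ i → Dec (Foot κ i)
  foot? κ i = i ≟ proj₁ (feet κ) ⊎-dec i ≟ proj₂ (feet κ)

  _≟β_ : (β γ : Fin n × Fin n) → Dec (β ≡ γ)
  _≟β_ = ×.≡-dec _≟_ _≟_

  _≟ᴷ_ : (κ κ′ : Key) → Dec (κ ≡ κ′)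
  _≟ᴷ_ = ⊎.≡-dec _≟_ _≟β_

  Edge : V → V → Set
  Edge (hub i)   (hub j)   = i ≢ j
  Edge (hub i)   (arm β a) = Foot (inj₂ β) i × toℕ a ≡ 0
  Edge (arm β a) (hub i)   = Foot (inj₂ β) i × toℕ a ≡ 0
  Edge (arm β a) (arm γ b) = β ≡ γ × (toℕ b ≡ suc (toℕ a) ⊎ toℕ a ≡ suc (toℕ b))

  edge? : ∀ x y → Dec (Edge x y)
  edge? (hub i)   (hub j)   = ¬? (i ≟ j)
  edge? (hub i)   (arm β a) = foot? (inj₂ β) i ×-dec toℕ a ≟ⁿ 0
  edge? (arm β a) (hub i)   = foot? (inj₂ β) i ×-dec toℕ a ≟ⁿ 0
  edge? (arm β a) (arm γ b) = β ≟β γ ×-dec (toℕ b ≟ⁿ suc (toℕ a) ⊎-dec toℕ a ≟ⁿ suc (toℕ b))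

  edge-sym : ∀ x y → Edge x y → Edge y x
  edge-sym (hub _)   (hub _)   e = e ∘ sym
  edge-sym (hub _)   (arm _ _) e = e
  edge-sym (arm _ _) (hub _)   e = e
  edge-sym (arm _ _) (arm _ _) (eq , inj₁ up)   = sym eq , inj₂ up
  edge-sym (arm _ _) (arm _ _) (eq , inj₂ down) = sym eq , inj₁ down

  edge-irrefl : ∀ x → ¬ Edge x x
  edge-irrefl (hub _)   e = e refl
  edge-irrefl (arm _ _) (_ , inj₁ eq) = 1+n≢n (sym eq)
  edge-irrefl (arm _ _) (_ , inj₂ eq) = 1+n≢n (sym eq)

  key-depth-injective : ∀ x y → key x ≡ key y → depth x ≡ depth y → x ≡ y
  key-depth-injective (hub _)   (hub _)   refl _  = refl
  key-depth-injective (arm _ _) (arm _ _) refl eq = cong (arm _) (toℕ-injective (suc-injective eq))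

  edge-depth : ∀ x y → Edge x y → depth x ≤ suc (depth y)
  edge-depth (hub _)   _         _ = z≤n
  edge-depth (arm _ _) (hub _)   (_ , eq) = s≤s (≤-reflexive eq)
  edge-depth (arm _ _) (arm _ _) (_ , inj₁ eq) =
    s≤s (≤-trans (n≤1+n _) (≤-trans (≤-reflexive (sym eq)) (n≤1+n _)))
  edge-depth (arm _ _) (arm _ _) (_ , inj₂ eq) = s≤s (≤-reflexive eq)

  crossing-depth : ∀ x y → Edge x y → key x ≢ key y → depth x + depth y ≤ 1
  crossing-depth (hub _)   (hub _)   _ _ = z≤n
  crossing-depth (hub _)   (arm _ _) (_ , eq) _ = s≤s (≤-reflexive eq)
  crossing-depth (arm _ _) (hub _)   (_ , eq) _ rewrite eq = s≤s z≤n
  crossing-depth (arm _ _) (arm _ _) (refl , _) ne = contradiction refl ne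

  -- Positive total depth rules out clique edges. What remains joins an arm to a hub, and that hub
  -- is the common foot.
  crossing-foot : ∀ x y → Edge x y → key x ≢ key y → 1 ≤ depth x + depth y →
    ∃ λ i → Foot (key x) i × Foot (key y) i × (x ≡ hub i ⊎ y ≡ hub i)
  crossing-foot (hub i)   (arm _ _) (f , _) _ _ = i , inj₁ refl , f , inj₁ refl
  crossing-foot (arm _ _) (hub i)   (f , _) _ _ = i , f , inj₁ refl , inj₂ refl
  crossing-foot (arm _ _) (arm _ _) (refl , _) ne _ = contradiction refl ne

  hub-foot : ∀ x → depth x ≡ 0 → ∀ {i} → Foot (key x) i → x ≡ hub i
  hub-foot (hub _) _ (inj₁ refl) = refl
  hub-foot (hub _) _ (inj₂ refl) = refl

  depth-zero : ∀ x y → key x ≡ key y → depth x ≡ 0 → depth y ≡ 0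
  depth-zero (hub _) (hub _) _ _ = refl

  abstract
    -- Opaque, so that `view` and `vertex` do not unfold to arithmetic on `Fin`; only the inverse
    -- laws are used.
    vertices : Fin (n + n * n * ℓ) ↔ V
    vertices = ↔-trans +↔⊎ (↔-refl ⊎-↔ ↔-trans *↔× (*↔× ×-↔ ↔-refl))

  open Inverse vertices using () renaming (to to view; from to vertex) public

  view-vertex : ∀ x → view (vertex x) ≡ x
  view-vertex = Inverse.strictlyInverseˡ vertices

  vertex-view : ∀ x → vertex (view x) ≡ x
  vertex-view = Inverse.strictlyInverseʳ vertices

  view-injective : ∀ {x y} → view x ≡ view y → x ≡ y
  view-injective {x} {y} eq = trans (sym (vertex-view x)) (trans (cong vertex eq) (vertex-view y))

  G : Graph
  G = record
    { size   = n + n * n * ℓ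
    ; Adj    = λ x y → does (edge? (view x) (view y))
    ; sym    = λ x y → does-⇔ (mk⇔ (edge-sym (view x) (view y)) (edge-sym (view y) (view x)))
                              (edge? _ _) (edge? _ _)
    ; irrefl = λ x → dec-false (edge? _ _) (edge-irrefl (view x))
    }

  κ : Fin (size G) → Key
  κ x = key (view x)

  δ : Fin (size G) → ℕ
  δ x = depth (view x)

  Adj→Edge : ∀ {x y} → Adj G x y ≡ true → Edge (view x) (view y)
  Adj→Edge = Equivalence.to (does⇔ (edge? _ _))

  κδ-injective : ∀ {x y} → κ x ≡ κ y → δ x ≡ δ y → x ≡ y
  κδ-injective eqκ eqδ = view-injective (key-depth-injective _ _ eqκ eqδ)

  -- Distances in an induced subgraph.

  module InducedSubgraph (S : VSet G) where

    W : ℕ → Fin (size G) → Fin (size G) → Set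
    W = Walk G S

    -- An intermediate value argument: a step changes the depth by at most one, and a branch can be
    -- entered only at depth at most 1, hence at most m. So the walk visits depth m on the branch of
    -- y.
    ascend : ∀ {k x y m} → W k x y → (κ x ≡ κ y → δ x ≤ m) → m ≤ δ y → 1 ≤ m →
      ∃ λ z → κ z ≡ κ y × δ z ≡ m × W k x z
    ascend (here s) below above _ = _ , refl , ≤-antisym (below refl) above , here s
    ascend {suc k} {x} {y} {m} (step {z = z} s adj w) below above pos
      with κ x ≟ᴷ κ y
    ... | no ≢ = u , eqκ , eqδ , step s adj w′
      where
      low : κ z ≡ κ y → δ z ≤ m
      low z≡y = ≤-trans (m≤n+m _ _)
        (≤-trans (crossing-depth (view x) (view z) (Adj→Edge adj) (λ eq → ≢ (trans eq z≡y))) pos)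
      rec = ascend w low above pos
      u = proj₁ rec
      eqκ = proj₁ (proj₂ rec)
      eqδ = proj₁ (proj₂ (proj₂ rec))
      w′ = proj₂ (proj₂ (proj₂ rec))
    ... | yes x≡y with m≤n⇒m<n∨m≡n (below x≡y)
    ... | inj₂ eq = _ , x≡y , eq , here s
    ... | inj₁ lt with ascend w (λ _ → ≤-trans (edge-depth (view z) (view x) (edge-sym (view x) (view z) (Adj→Edge adj))) lt)
                         above pos
    ... | u , eqκ , eqδ , w′ = u , eqκ , eqδ , step s adj w′

    -- The mirror image of `ascend`: a branch can be left only from depth at most 1.
    descend : ∀ {k x y m} → W k x y → m ≤ δ x → (κ y ≡ κ x → δ y ≤ m) → 1 ≤ m →
      ∃ λ z → κ z ≡ κ x × δ z ≡ m × W k x z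
    descend (here s) above below _ = _ , refl , ≤-antisym (below refl) above , here s
    descend {x = x} (step {z = z} s adj w) above below pos with m≤n⇒m<n∨m≡n above
    ... | inj₂ eq = _ , refl , sym eq , here s
    ... | inj₁ lt with κ x ≟ᴷ κ z
    ... | no ≢ = contradiction
      (≤-trans lt (≤-trans (m≤m+n _ _) (crossing-depth (view x) (view z) (Adj→Edge adj) ≢))) (<⇒≱ (s≤s pos))
    ... | yes eq with descend w (≤-pred (≤-trans lt (edge-depth (view x) (view z) (Adj→Edge adj))))
                        (λ y≡z → below (trans y≡z (sym eq))) pos
    ... | u , eqκ , eqδ , w′ = u , trans eqκ (sym eq) , eqδ , step s adj w′

    -- If v lies on the branch of y and at least as deep, the walk to x descends through y.
    -- Otherwise the walk to z climbs through y.
    convex : ∀ {k v x y z} → κ x ≡ κ y → κ z ≡ κ y → δ x < δ y → δ y < δ z →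
      W k v x → W k v z → W k v y
    convex {k} {v} {x} {y} {z} x≡y z≡y x<y y<z wx wz with ≤-total (δ v) (δ y)
    ... | inj₁ v≤y with ascend wz (λ _ → v≤y) (<⇒≤ y<z) (≤-trans (s≤s z≤n) x<y)
    ... | u , eqκ , eqδ , w = subst (W k v) (κδ-injective (trans eqκ z≡y) eqδ) w
    convex {k} {v} {x} {y} {z} x≡y z≡y x<y y<z wx wz | inj₂ y≤v with κ v ≟ᴷ κ y
    ... | yes v≡y with descend wx y≤v (λ _ → <⇒≤ x<y) (≤-trans (s≤s z≤n) x<y)
    ... | u , eqκ , eqδ , w = subst (W k v) (κδ-injective (trans eqκ v≡y) eqδ) w
    convex {k} {v} {x} {y} {z} x≡y z≡y x<y y<z wx wz | inj₂ y≤v | no v≢y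
      with ascend wz (λ v≡z → contradiction (trans v≡z z≡y) v≢y) (<⇒≤ y<z) (≤-trans (s≤s z≤n) x<y)
    ... | u , eqκ , eqδ , w = subst (W k v) (κδ-injective (trans eqκ z≡y) eqδ) w

    -- The two bounds are proved together because the first step may enter or leave the branch of y.
    -- A step between branches gains at most one, by `crossing-depth`.
    depth-bound : ∀ {k x y} → W k x y → (κ x ≡ κ y → δ y ≤ k + δ x) × (κ x ≢ κ y → δ x + δ y ≤ k)
    depth-bound (here _) = (λ _ → m≤n+m _ _) , (λ ≢ → contradiction refl ≢)
    depth-bound {suc k} {x} {y} (step {z = z} s adj w) = same , diff
      where
      e = Adj→Edge adj
      same′ = proj₁ (depth-bound w)
      diff′ = proj₂ (depth-bound w)
      open ≤-Reasoning
      z≤ : δ z ≤ suc (δ x)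
      z≤ = edge-depth (view z) (view x) (edge-sym (view x) (view z) e)
      same : κ x ≡ κ y → δ y ≤ suc k + δ x
      same eq with κ z ≟ᴷ κ y
      ... | yes z≡y = begin
        δ y             ≤⟨ same′ z≡y ⟩
        k + δ z         ≤⟨ +-monoʳ-≤ k z≤ ⟩
        k + suc (δ x)   ≡⟨ +-suc k (δ x) ⟩
        suc k + δ x     ∎
      ... | no z≢y = begin
        δ y             ≤⟨ m≤n+m _ _ ⟩
        δ z + δ y       ≤⟨ diff′ z≢y ⟩
        k               ≤⟨ n≤1+n k ⟩
        suc k           ≤⟨ m≤m+n _ _ ⟩
        suc k + δ x     ∎
      diff : κ x ≢ κ y → δ x + δ y ≤ suc k
      diff ne with κ z ≟ᴷ κ y
      ... | yes z≡y = begin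
        δ x + δ y       ≤⟨ +-monoʳ-≤ (δ x) (same′ z≡y) ⟩
        δ x + (k + δ z) ≡⟨ cong (δ x +_) (+-comm k (δ z)) ⟩
        δ x + (δ z + k) ≡⟨ sym (+-assoc (δ x) (δ z) k) ⟩
        δ x + δ z + k   ≤⟨ +-monoˡ-≤ k (crossing-depth (view x) (view z) e (λ eq → ne (trans eq z≡y))) ⟩
        suc k           ∎
      ... | no z≢y = begin
        δ x + δ y       ≤⟨ +-monoˡ-≤ (δ y) (edge-depth (view x) (view z) e) ⟩
        suc (δ z + δ y) ≤⟨ s≤s (diff′ z≢y) ⟩
        suc k           ∎

    In : Fin n → Set
    In i = S (vertex (hub i)) ≡ true

    hub-in : ∀ {x i} → view x ≡ hub i → S x ≡ true → In i
    hub-in {x} eq s = subst (λ y → S y ≡ true) (trans (sym (vertex-view x)) (cong vertex eq)) s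

    -- The case ε = 0 of the distance formula.
    Meet : Fin (size G) → Fin (size G) → Set
    Meet x y = ∃ λ i → Foot (κ x) i × Foot (κ y) i × In i

    -- By `depth-bound` such a walk is as short as possible. This leaves no step for a clique edge,
    -- so it passes between the branches through a single hub.
    shared-foot : ∀ {k x y} → W k x y → κ x ≢ κ y → k ≤ δ x + δ y → Meet x y
    shared-foot (here _) ne _ = contradiction refl ne
    shared-foot {suc k} {x} {y} (step {z = z} s adj w) ne short with κ z ≟ᴷ κ y
    ... | yes z≡y = i , fx , subst (λ κ′ → Foot κ′ i) z≡y fz ,
          [ (λ eq → hub-in eq s) , (λ eq → hub-in eq (walk-start w)) ]′ eqs
      where
      open ≤-Reasoning
      pos : 1 ≤ δ x + δ z
      pos = +-cancelʳ-≤ k 1 (δ x + δ z) (begin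
        suc k           ≤⟨ short ⟩
        δ x + δ y       ≤⟨ +-monoʳ-≤ (δ x) (proj₁ (depth-bound w) z≡y) ⟩
        δ x + (k + δ z) ≡⟨ cong (δ x +_) (+-comm k (δ z)) ⟩
        δ x + (δ z + k) ≡⟨ sym (+-assoc (δ x) (δ z) k) ⟩
        δ x + δ z + k   ∎)
      cross = crossing-foot (view x) (view z) (Adj→Edge adj) (λ eq → ne (trans eq z≡y)) pos
      i = proj₁ cross
      fx = proj₁ (proj₂ cross)
      fz = proj₁ (proj₂ (proj₂ cross))
      eqs = proj₂ (proj₂ (proj₂ cross))
    ... | no z≢y with shared-foot w z≢y
                        (≤-pred (≤-trans short (+-monoˡ-≤ (δ y) (edge-depth (view x) (view z) (Adj→Edge adj)))))
    ... | i , fz , fy , in-i with κ x ≟ᴷ κ z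
    ... | yes x≡z = i , subst (λ κ′ → Foot κ′ i) (sym x≡z) fz , fy , in-i
    ... | no x≢z = i , fx , fy , in-i
      where
      -- The rest of the walk needs δ z + δ y steps, so the step to z must lower the depth. As it
      -- also changes the branch, z is a hub, namely hub i.
      z<x : δ z < δ x
      z<x = +-cancelʳ-< (δ y) (δ z) (δ x) (≤-trans (s≤s (proj₂ (depth-bound w) z≢y)) short)
      crossing : δ x + δ z ≤ 1
      crossing = crossing-depth (view x) (view z) (Adj→Edge adj) x≢z
      z≡0 : δ z ≡ 0
      z≡0 = n≤0⇒n≡0 (≤-pred (≤-trans z<x (≤-trans (m≤m+n _ _) crossing)))
      cross = crossing-foot (view x) (view z) (Adj→Edge adj) x≢z (≤-trans (≤-trans (s≤s z≤n) z<x) (m≤m+n _ _))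
      same-hub : hub (proj₁ cross) ≡ hub i
      same-hub = trans (sym (hub-foot (view z) z≡0 (proj₁ (proj₂ (proj₂ cross)))))
        (hub-foot (view z) z≡0 fz)
      fx : Foot (κ x) i
      fx = subst (Foot (κ x)) (⊎.inj₁-injective same-hub) (proj₁ (proj₂ cross))

    -- x is joined to the clique of surviving hubs by its own branch.
    Rooted : Fin (size G) → Set
    Rooted x = (∀ {y} → κ y ≡ κ x → δ y ≤ δ x → S y ≡ true) × ∃ λ i → Foot (κ x) i × In i

    -- To leave its branch, a walk from x must pass through every smaller depth on it and then cross
    -- at a hub.
    rooted : ∀ {k x y} → W k x y → κ x ≢ κ y → Rooted x
    rooted (here _) ne = contradiction refl ne
    rooted {x = x} (step {z = z} s adj w) ne with κ x ≟ᴷ κ z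
    ... | yes x≡z = closed , subst (λ κ′ → ∃ λ i → Foot κ′ i × In i) (sym x≡z) (proj₂ rec)
      where
      rec = rooted w (λ z≡y → ne (trans x≡z z≡y))
      closed : ∀ {y} → κ y ≡ κ x → δ y ≤ δ x → S y ≡ true
      closed y≡x y≤x with m≤n⇒m<n∨m≡n y≤x
      ... | inj₂ eq = subst (λ u → S u ≡ true) (sym (κδ-injective y≡x eq)) s
      ... | inj₁ lt = proj₁ rec (trans y≡x x≡z) (≤-pred (≤-trans lt (edge-depth (view x) (view z) (Adj→Edge adj))))
    ... | no x≢z = closed , foot
      where
      e = Adj→Edge adj
      closed : ∀ {y} → κ y ≡ κ x → δ y ≤ δ x → S y ≡ true
      closed {y} y≡x y≤x with m≤n⇒m<n∨m≡n y≤x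
      ... | inj₂ eq = subst (λ u → S u ≡ true) (sym (κδ-injective y≡x eq)) s
      ... | inj₁ lt = contradiction (subst (δ y <_) x≡0 lt) λ ()
        where
        y≡0 : δ y ≡ 0
        y≡0 = n≤0⇒n≡0 (≤-pred (≤-trans lt
          (≤-trans (m≤m+n _ _) (crossing-depth (view x) (view z) e x≢z))))
        x≡0 = depth-zero (view y) (view x) y≡x y≡0
      foot : ∃ λ i → Foot (κ x) i × In i
      -- A hub may leave by a clique edge, where `crossing-foot` does not apply, but it is its own
      -- foot.
      foot with δ x ≟ⁿ 0
      ... | yes eq = _ , inj₁ refl , hub-in (hub-foot (view x) eq (inj₁ refl)) s
      ... | no ne′ with crossing-foot (view x) (view z) e x≢z (≤-trans (n≢0⇒n>0 ne′) (m≤m+n _ _))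
      ... | i , fx , _ , eqs = i , fx , [ (λ eq → hub-in eq s) , (λ eq → hub-in eq (walk-start w)) ]′ eqs

    parent : ∀ x {i} → Foot (key x) i → 1 ≤ depth x →
      ∃ λ y → Edge x y × depth x ≡ suc (depth y) × (y ≡ hub i ⊎ key y ≡ key x)
    parent (arm β zero)    f _ = hub _ , (f , refl) , refl , inj₁ refl
    parent (arm β (suc a)) f _ =
      arm β (inject₁ a) , (refl , inj₂ eq) , cong suc eq , inj₂ refl
      where eq = cong suc (sym (toℕ-inject₁ a))

    -- Induction on the depth m; `Rooted` passes to the parent on the same branch, which is less
    -- deep.
    to-hub : ∀ {m x i} → δ x ≡ m → Rooted x → Foot (κ x) i → In i → W m x (vertex (hub i))
    to-hub {zero} {x} {i} eq (closed , _) f _ =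
      subst (W 0 x) (view-injective (trans (hub-foot (view x) eq f) (sym (view-vertex _))))
        (here (closed refl ≤-refl))
    to-hub {suc m} {x} {i} eq (closed , root) f in-i
      with parent (view x) f (subst (1 ≤_) (sym eq) (s≤s z≤n))
    ... | y , e , δeq , next = step (closed refl ≤-refl)
      (dec-true (edge? _ _) (subst (Edge (view x)) (sym (view-vertex y)) e)) (rest next)
      where
      v = vertex y
      δv : depth (view v) ≡ m
      δv = trans (cong depth (view-vertex y)) (suc-injective (trans (sym δeq) eq))
      rest : y ≡ hub i ⊎ key y ≡ key (view x) → W m v (vertex (hub i))
      rest (inj₁ refl) = here in-i
      rest (inj₂ keq) = to-hub δv
        ( (λ u≡v u≤v → closed (trans u≡v v≡x) (≤-trans u≤v v≤x))
        , subst (λ κ′ → ∃ λ i → Foot κ′ i × In i) (sym v≡x) root )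
        (subst (λ κ′ → Foot κ′ i) (sym v≡x) f) in-i
        where
        v≡x : κ v ≡ κ x
        v≡x = trans (cong key (view-vertex y)) keq
        v≤x : δ v ≤ δ x
        v≤x = subst (_≤ δ x) (sym δv) (subst (m ≤_) (sym eq) (n≤1+n m))

    -- `join-meet` and `join` are the upper bounds of the distance formula, for ε = 0 and ε = 1. The
    -- lower bounds are `depth-bound` and `shared-foot`.
    join-meet : ∀ {x y} → Rooted x → Rooted y → Meet x y → W (δ x + δ y) x y
    join-meet rx ry (i , fx , fy , in-i) =
      walk-append (to-hub refl rx fx in-i) (walk-reverse (to-hub refl ry fy in-i))

    join : ∀ {x y} → Rooted x → Rooted y → W (suc (δ x + δ y)) x y
    join {x} {y} rx@(_ , i , fx , in-i) ry@(_ , j , fy , in-j) with i ≟ j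
    ... | yes refl = walk-weaken (n≤1+n _) (join-meet rx ry (i , fx , fy , in-i))
    ... | no i≢j = subst (λ k → W k x y) (+-suc (δ x) (δ y))
      (walk-append (to-hub refl rx fx in-i) (step in-i adj (walk-reverse (to-hub refl ry fy in-j))))
      where
      adj : Adj G (vertex (hub i)) (vertex (hub j)) ≡ true
      adj rewrite view-vertex (hub i) | view-vertex (hub j) = dec-true (edge? (hub i) (hub j)) i≢j

-- Shattered sets have at most 18 points.

module Shattering (n ℓ : ℕ) (S : VSet (Hubs-and-arms.G n ℓ)) (d : ℕ)
  (X : Fin d → Fin (size (Hubs-and-arms.G n ℓ))) (shattered : ShatteredB (Hubs-and-arms.G n ℓ) S d X)
  where

  open Hubs-and-arms n ℓ
  open InducedSubgraph S

  κX : Fin d → Key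
  κX t = κ (X t)

  δX : Fin d → ℕ
  δX t = δ (X t)

  centre : ∀ {P : Fin d → Set} → Decidable P → ∃₂ λ v k → ∀ t → W k v (X t) ⇔ P t
  centre P? with proj₂ (proj₂ shattered) (does ∘ P?)
  ... | v , _ , k , iff = v , k , λ t →
    mk⇔ (to (does⇔ (P? t)) ∘ to (iff t)) (from (iff t) ∘ from (does⇔ (P? t)))

  -- A ball that omits only y contradicts `convex`.
  no-middle : ∀ {x y z} → κX x ≡ κX y → κX z ≡ κX y → δX x < δX y → δX y < δX z → ⊥
  no-middle {x} {y} {z} x≡y z≡y x<y y<z with centre (λ t → ¬? (t ≟ y))
  ... | v , k , iff = to (iff y)
    (convex x≡y z≡y x<y y<z (from (iff x) λ { refl → <-irrefl refl x<y })
                            (from (iff z) λ { refl → <-irrefl refl y<z })) refl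

  -- Distinct points of one branch differ in depth, so one of three would lie in the middle.
  at-most-two : ∀ {x y z} → x ≢ y → x ≢ z → y ≢ z → κX x ≡ κX y → κX x ≡ κX z → ⊥
  at-most-two {x} {y} {z} x≢y x≢z y≢z xy xz
    with <-cmp (δX x) (δX y) | <-cmp (δX x) (δX z) | <-cmp (δX y) (δX z)
  ... | tri≈ _ eq _ | _ | _ = x≢y (proj₁ shattered _ _ (κδ-injective xy eq))
  ... | _ | tri≈ _ eq _ | _ = x≢z (proj₁ shattered _ _ (κδ-injective xz eq))
  ... | _ | _ | tri≈ _ eq _ = y≢z (proj₁ shattered _ _ (κδ-injective (trans (sym xy) xz) eq))
  ... | tri< x<y _ _ | _ | tri< y<z _ _ = no-middle xy (trans (sym xz) xy) x<y y<z
  ... | tri> _ _ y<x | tri< x<z _ _ | _ = no-middle (sym xy) (sym xz) y<x x<z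
  ... | _ | tri< x<z _ _ | tri> _ _ z<y = no-middle xz (trans (sym xy) xz) x<z z<y
  ... | _ | tri> _ _ z<x | tri< y<z _ _ = no-middle (trans (sym xy) xz) xz y<z z<x
  ... | tri< x<y _ _ | tri> _ _ z<x | _ = no-middle (sym xz) (sym xy) z<x x<y
  ... | tri> _ _ y<x | _ | tri> _ _ z<y = no-middle (trans (sym xz) xy) xy z<y y<x

  -- The distance formula needs distinct branches; this finds a point off the branch of a given
  -- centre.
  foreign : ∀ {s t} κ₀ → κX s ≢ κX t → κ₀ ≢ κX s ⊎ κ₀ ≢ κX t
  foreign {s} κ₀ s≢t with κ₀ ≟ᴷ κX s
  ... | yes refl = inj₂ s≢t
  ... | no ≢ = inj₁ ≢

  -- The ball that contains all of X links X t to both a and b, and one of them lies on another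
  -- branch.
  rootedX : ∀ {a b} → κX a ≢ κX b → ∀ t → Rooted (X t)
  rootedX {a} {b} a≢b t with centre {P = λ _ → ⊤} (λ _ → yes tt)
  ... | v , k , iff with foreign (κX t) a≢b
  ... | inj₁ t≢a = rooted (walk-append (walk-reverse (from (iff t) tt)) (from (iff a) tt)) t≢a
  ... | inj₂ t≢b = rooted (walk-append (walk-reverse (from (iff t) tt)) (from (iff b) tt)) t≢b

  -- With a radius above δ v + δX w, `join` would reach w, even from its own branch.
  radius-bounds : ∀ {v k u w} → κ v ≢ κX u → Rooted (X w) → W k v (X u) → ¬ W k v (X w) →
    δ v + δX u ≤ k × k ≤ δ v + δX w
  radius-bounds v≢u rw wu ¬ww = proj₂ (depth-bound wu) v≢u ,
    ≮⇒≥ (λ lt → ¬ww (walk-weaken lt (join (rooted wu v≢u) rw)))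

  -- All points have the depth of w. A ball that misses w and contains a point off the branch of its
  -- centre v then has radius exactly δ v + δX w, so the points in it are those that `Meet` v.
  -- Keeping z in every ball guarantees such a point: z or g s₀.
  level-two-stars : ∀ {w z} (g : Fin 7 → Fin d) → (∀ {s t} → g s ≡ g t → s ≡ t) →
    z ≢ w → (∀ s → g s ≢ w) → (∀ s → κX z ≢ κX (g s)) → δX z ≡ δX w → (∀ s → δX (g s) ≡ δX w) → ⊥
  level-two-stars {w} {z} g g-inj z≢w g≢w z≢g δz δg =
    TwoStars.contradictory (λ s i → Foot (κX (g s)) i × In i)
      (λ s i → foot? (κX (g s)) i ×-dec (S (vertex (hub i)) ≟ᵇ true))
      (proj₁ ∘ feet ∘ κX ∘ g) (proj₂ ∘ feet ∘ κX ∘ g) proj₁ cover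
    where
    rX : ∀ t → Rooted (X t)
    rX = rootedX (z≢g zero)

    cover : ∀ {P : Fin 7 → Set} → Decidable P → ∀ s → P s →
      ∃₂ λ i j → ∀ t → P t ⇔ ((Foot (κX (g t)) i × In i) ⊎ (Foot (κX (g t)) j × In j))
    cover {P} P? s₀ p₀ with centre (λ t → t ≟ z ⊎-dec any? (λ s → g s ≟ t ×-dec P? s))
    ... | v , k , iff = proj₁ (feet (κ v)) , proj₂ (feet (κ v)) , λ t → mk⇔ (meets t) (met-inside t)
      where
      avoids-w : ¬ W k v (X w)
      avoids-w ww with to (iff w) ww
      ... | inj₁ eq = z≢w (sym eq)
      ... | inj₂ (s , eq , _) = g≢w s eq
      radius : ∀ u → W k v (X u) → δX u ≡ δX w → κ v ≢ κX u → k ≡ δ v + δX w × Rooted v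
      radius u wu eq ne with radius-bounds ne (rX w) wu avoids-w
      ... | lower , upper = ≤-antisym upper (subst (λ m → δ v + m ≤ k) eq lower) , rooted wu ne
      radius-fixed : k ≡ δ v + δX w × Rooted v
      radius-fixed with foreign (κ v) (z≢g s₀)
      ... | inj₁ ne = radius z (from (iff z) (inj₁ refl)) δz ne
      ... | inj₂ ne = radius (g s₀) (from (iff (g s₀)) (inj₂ (s₀ , refl , p₀))) (δg s₀) ne
      k≡ : ∀ t → k ≡ δ v + δX (g t)
      k≡ t = trans (proj₁ radius-fixed) (cong (δ v +_) (sym (δg t)))
      meet : ∀ t → P t → Meet v (X (g t))
      meet t p with κ v ≟ᴷ κX (g t) | rX (g t)
      ... | no ne | _ = shared-foot (from (iff (g t)) (inj₂ (t , refl , p))) ne (≤-reflexive (k≡ t))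
      -- On the branch of the centre, the surviving foot of g t is also a foot of v.
      ... | yes eq | (_ , i , f , in-i) = i , subst (λ κ′ → Foot κ′ i) (sym eq) f , f , in-i
      meets : ∀ t → P t → _
      meets t p with meet t p
      ... | i , inj₁ refl , f , in-i = inj₁ (f , in-i)
      ... | i , inj₂ refl , f , in-i = inj₂ (f , in-i)
      covered : ∀ t {i} → Foot (κ v) i → Foot (κX (g t)) i × In i → P t
      covered t fv (f , in-i)
        with to (iff (g t)) (subst (λ m → W m v (X (g t))) (sym (k≡ t))
             (join-meet (proj₂ radius-fixed) (rX (g t)) (_ , fv , f , in-i)))
      ... | inj₁ eq = contradiction (cong κX (sym eq)) (z≢g t)
      ... | inj₂ (s , eq , p) = subst P (g-inj eq) p
      met-inside : ∀ t → _ → P t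
      met-inside t = [ covered t (inj₁ refl) , covered t (inj₂ refl) ]′

  least-depth : ∀ {w} ys → All (λ t → δX w ≤ δX t) ys → AllPairs (λ s t → κX s ≢ κX t) ys →
    (∀ t → Rooted (X t)) → 10 ≤ length ys → ⊥
  least-depth {w} ys w-least keys rX len = finish others others-keys others⊆ others-len
    where
    level? : Decidable (λ t → δX t ≡ δX w)
    level? t = δX t ≟ⁿ δX w
    other? : Decidable (λ t → t ≢ w)
    other? t = ¬? (t ≟ w)
    -- One of s and t lies off the branch of the centre of a ball that omits only w, and
    -- `radius-bounds` keeps it from being deeper than w.
    high : ∀ {s t} → δX w ≤ δX s → δX w ≤ δX t → κX s ≢ κX t → δX s ≢ δX w → δX t ≢ δX w → ⊥
    high {s} {t} ws wt s≢t s≢w t≢w with centre other?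
    ... | v , k , iff = [ above ws s≢w , above wt t≢w ]′ (foreign (κ v) s≢t)
      where
      above : ∀ {u} → δX w ≤ δX u → δX u ≢ δX w → κ v ≢ κX u → ⊥
      above {u} le neq ne with radius-bounds ne (rX w)
                                 (from (iff u) (neq ∘ cong δX)) (λ ww → to (iff w) ww refl)
      ... | lower , upper = neq (≤-antisym (+-cancelˡ-≤ (δ v) _ _ (≤-trans lower upper)) le)
    level = filter level? ys
    others = filter other? level
    level-keys = AllPairsₚ.filter⁺ level? keys
    others-keys = AllPairsₚ.filter⁺ other? level-keys
    -- Of 10 points, `high` costs at most one and removing w at most one more. The 8 left are z and
    -- the 7 values of g.
    others-len : 8 ≤ length others
    others-len = ≤-pred (≤-pred (≤-trans len (≤-trans (filter-loses-one level? high w-least keys)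
      (s≤s (filter-loses-one {Q = λ _ → ⊤} other?
         (λ {s} {t} _ _ s≢t ¬s ¬t → s≢t
           (cong κX (trans (decidable-stable (s ≟ w) ¬s) (sym (decidable-stable (t ≟ w) ¬t)))))
         (All.universal (λ _ → tt) level) level-keys)))))
    others⊆ : ∀ {t} → t ∈ others → δX t ≡ δX w × t ≢ w
    others⊆ t∈ with ∈-filter⁻ other? {xs = level} t∈
    ... | t∈level , t≢w = proj₂ (∈-filter⁻ level? {xs = ys} t∈level) , t≢w
    finish : ∀ zs → AllPairs (λ s t → κX s ≢ κX t) zs →
      (∀ {t} → t ∈ zs → δX t ≡ δX w × t ≢ w) → 8 ≤ length zs → ⊥
    finish (z ∷ zs) (z≢ ∷ zs-keys) sub (s≤s le) =
      level-two-stars g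
        (λ {s} {t} → inject≤-injective le le s t ∘ lookup-injective (AllPairs.map (λ ne → ne ∘ cong κX) zs-keys) _ _)
        (proj₂ (sub (here refl))) (λ s → proj₂ (sub (there (∈-lookup _))))
        (λ s → All.lookup z≢ (∈-lookup _)) (proj₁ (sub (here refl))) (λ s → proj₁ (sub (there (∈-lookup _))))
      where
      g : Fin 7 → Fin d
      g s = lookup zs (inject≤ s le)

  distinct-branches : ∀ ys → AllPairs (λ s t → κX s ≢ κX t) ys → 10 ≤ length ys → ⊥
  distinct-branches (_ ∷ []) _ (s≤s ())
  distinct-branches (x ∷ x′ ∷ xs) keys@((x≢x′ ∷ _) ∷ _) len = least-depth (x ∷ x′ ∷ xs)
    (f[argmin]≤f[⊤] {f = δX} x (x′ ∷ xs) ∷ f[argmin]≤f[xs] {f = δX} x (x′ ∷ xs)) keys (rootedX x≢x′) len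

  d≤18 : d ≤ 18
  d≤18 = ≮⇒≥ λ 18<d →
    -- Here 10 * 2 ≤ suc 19.
    let xs , keys , len , _ = distinctKeys _≟ᴷ_ κX at-most-two 10 (allFin d) (allFin⁺ d)
                                (s≤s (subst (19 ≤_) (sym (length-tabulate id)) 18<d))
    in distinct-branches xs keys len

-- The hubs are 2-shattered by balls around the tips of arms.

module _ (n ℓ : ℕ) where

  open Hubs-and-arms n (suc ℓ)
  open InducedSubgraph (allVertices G)

  twoShattered : TwoShatteredBℓ G (suc ℓ) n (vertex ∘ hub)
  twoShattered = inj , λ i j _ → tip (i , j) , λ t → mk⇔ (near t) (reach t)
    where
    inj : Inj (vertex ∘ hub)
    inj i j eq = ⊎.inj₁-injective (trans (sym (view-vertex (hub i))) (trans (cong view eq) (view-vertex (hub j))))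
    tip : Fin n × Fin n → Fin (size G)
    tip β = vertex (arm β (fromℕ ℓ))
    κtip : ∀ β → κ (tip β) ≡ inj₂ β
    κtip β = cong key (view-vertex (arm β (fromℕ ℓ)))
    δtip : ∀ β → δ (tip β) ≡ suc ℓ
    δtip β = trans (cong depth (view-vertex (arm β (fromℕ ℓ)))) (cong suc (toℕ-fromℕ ℓ))
    κhub : ∀ t → κ (vertex (hub t)) ≡ inj₁ t
    κhub t = cong key (view-vertex (hub t))
    -- The depth of the tip equals the radius and hubs have depth 0, so the walk has no slack and
    -- `shared-foot` applies.
    near : ∀ {β} t → W (suc ℓ) (tip β) (vertex (hub t)) → Foot (inj₂ β) t
    near {β} t walk with shared-foot walk
      (λ eq → case trans (sym (κtip β)) (trans eq (κhub t)) of λ ())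
      (≤-trans (≤-reflexive (sym (δtip β))) (m≤m+n _ _))
    ... | i , fβ , ft , _ = subst (λ i → Foot (inj₂ β) i) i≡t (subst (λ κ′ → Foot κ′ i) (κtip β) fβ)
      where
      i≡t : i ≡ t
      i≡t = [ id , id ]′ (subst (λ κ′ → Foot κ′ i) (κhub t) ft)
    reach : ∀ {β} t → Foot (inj₂ β) t → W (suc ℓ) (tip β) (vertex (hub t))
    reach {β} t f = to-hub (δtip β) ((λ _ _ → refl) , _ , inj₁ refl , refl)
      (subst (λ κ′ → Foot κ′ t) (sym (κtip β)) f) refl

theorem8 : ∀ (n ℓ : ℕ) → 1 ≤ n → 1 ≤ ℓ →
    Σ Graph λ G → DistVCdim≤ G 18 × TwoVCdimBℓ≥ G ℓ n
theorem8 n (suc ℓ) _ _ =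
  Hubs-and-arms.G n (suc ℓ) , Shattering.d≤18 n (suc ℓ) , n , ≤-refl , _ , twoShattered n ℓ
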